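{- $\mathfrak{cp}(\mathsf{null}\setminus\{\emptyset\},\subseteq)=\operatorname{cof}(\mathsf{null})$.
   Context: $\mathsf{null}$ is the ideal of Lebesgue measure zero subsets of $2^\omega$, here ordered by inclusion. For a poset $(P,\le)$, $F\subseteq P$ is a comparable family if for every $p\in P$ there is $q\in F$ with $p\le q$ or $q\le p$; $\mathfrak{cp}(P)$ is the minimal size of a comparable family. $\operatorname{cof}(\mathsf{null})$ is the minimal size of a family $\mathcal{F}\subseteq\mathsf{null}$ such that every null set is contained in some member of $\mathcal{F}$. -}

module Defs where

open import Level using (Level; 0ℓ; _⊔_) renaming (suc to lsuc)
open import Data.Bool using (Bool)
open import Data.Fin using (toℕ)
open import Data.List using (List; []; _∷_; length; lookup)
open import Data.Nat using (ℕ; zero; suc)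
open import Data.Product using (Σ; ∃; _×_; _,_; proj₁)
open import Data.Rational using (ℚ; 0ℚ; 1ℚ; ½; _+_; _*_; _≤_; _<_)
open import Data.Sum using (_⊎_)
open import Function.Bundles using (Func; Surjection; Injection; Bijection)
open import Relation.Binary using (Poset; Setoid; _Respects_)
import Relation.Binary.Construct.On as On
open import Relation.Binary.PropositionalEquality using (_≡_; _≗_; setoid)
open import Relation.Nullary using (¬_)
open import Relation.Unary using (Pred; _∈_; _≐_; ∅)
open import Relation.Unary.Relation.Binary.Subset using (⊆-poset)

-- Since ∃ is Σ in Agda, "every total relation contains a function" is
-- provable outright; it carries no content because the function need not
-- respect any equality but _≡_.  The set-theoretic axiom is the extensional
-- one: a surjection of setoids has a section that is itself a setoid map.
AxiomOfChoice : ∀ a ℓ₁ b ℓ₂ → Set (lsuc (a ⊔ ℓ₁ ⊔ b ⊔ ℓ₂))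
AxiomOfChoice a ℓ₁ b ℓ₂ =
  (S : Setoid a ℓ₁) (T : Setoid b ℓ₂) (f : Surjection S T) →
  Σ (Func T S) λ g → ∀ y → Setoid._≈_ T (Surjection.to f (Func.to g y)) y

module _ {c ℓ₁ ℓ₂ : Level} (P : Poset c ℓ₁ ℓ₂) where
  private module P = Poset P

  record Family : Set (lsuc c ⊔ ℓ₁) where
    field
      member   : Pred P.Carrier c
      respects : member Respects P._≈_

  -- Two members of a family count as one when they are equal in P.
  members : Family → Setoid c ℓ₁
  members F = On.setoid P.Eq.setoid (proj₁ {B = Family.member F})

  IsComparable : Family → Set (c ⊔ ℓ₂)
  IsComparable F = ∀ p → ∃ λ q → q ∈ Family.member F × (p P.≤ q ⊎ q P.≤ p)

  IsCofinal : Family → Set (c ⊔ ℓ₂)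
  IsCofinal F = ∀ p → ∃ λ q → q ∈ Family.member F × p P.≤ q

  -- Cardinals are represented by types K, up to bijection: K is the least
  -- cardinality of a family satisfying Q.
  IsMinimalSize : (Family → Set (c ⊔ ℓ₂)) → Set c → Set (lsuc c ⊔ ℓ₁ ⊔ ℓ₂)
  IsMinimalSize Q K =
    (∃ λ F → Q F × Bijection (setoid K) (members F)) ×
    (∀ F → Q F → Injection (setoid K) (members F))

  Is-𝔠𝔭 : Set c → Set (lsuc c ⊔ ℓ₁ ⊔ ℓ₂)
  Is-𝔠𝔭 = IsMinimalSize IsComparable

  Is-cof : Set c → Set (lsuc c ⊔ ℓ₁ ⊔ ℓ₂)
  Is-cof = IsMinimalSize IsCofinal

2^ω : Set
2^ω = ℕ → Bool

[_] : List Bool → Pred 2^ω 0ℓ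
[ s ] x = ∀ i → x (toℕ i) ≡ lookup s i

μ : List Bool → ℚ
μ []      = 1ℚ
μ (_ ∷ s) = ½ * μ s

∑[_<_] : (ℕ → ℚ) → ℕ → ℚ
∑[ f < zero  ] = 0ℚ
∑[ f < suc n ] = ∑[ f < n ] + f n

-- Outer measure zero: for every ε > 0 there is a countable cover by basic
-- clopen sets whose measures have sum (supremum of the partial sums) ≤ ε.
IsNull : Pred 2^ω 0ℓ → Set
IsNull X = ∀ ε → 0ℚ < ε → Σ (ℕ → List Bool) λ s →
  (∀ x → x ∈ X → ∃ λ n → x ∈ [ s n ]) ×
  (∀ n → ∑[ (λ k → μ (s k)) < n ] ≤ ε)

-- Without function extensionality, a subset of 2^ω is a predicate that does
-- not distinguish pointwise equal sequences.
record NullSet : Set₁ where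
  field
    set      : Pred 2^ω 0ℓ
    respects : set Respects _≗_
    isNull   : IsNull set

null : Poset (lsuc 0ℓ) 0ℓ 0ℓ
null = On.poset (⊆-poset 2^ω 0ℓ) NullSet.set

null∖❴∅❵ : Poset (lsuc 0ℓ) 0ℓ 0ℓ
null∖❴∅❵ = On.poset null (proj₁ {B = λ X → ¬ (NullSet.set X ≐ ∅)})

{-# OPTIONS --safe #-}

-- A cofinal family without ∅ is comparable.  Conversely let G be comparable
-- and pick a point x_q in every q ∈ G; write X for the set of these points.
-- If Y is null then no q ∈ G is included in Y ∖ X, so Y ∖ X is included in
-- some q ∈ G.  If X is disjoint from its translate X ⊕ t, take
-- Y = N ∪ (N ⊕ t): then N ⊆ q ∪ (q ⊕ t), and the sets q ∪ (q ⊕ t) are cofinal.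
--
-- For r ∈ 2^ω let branch r be the characteristic function of the set of
-- prefixes of r, and choose representatives modulo the group of those v that
-- vanish eventually along all but countably many r; call these countably many
-- r the support of v, and the support of x that of x minus its representative.
-- If x and x ⊕ branch r are both in X, then r is in the support of one of them.
-- So either some t = branch r is as required, or 2^ω is the union of the
-- supports of the points x_q.  In the latter case, by Kőnig's argument, for one
-- n the n-th elements of the supports already code all G_δ sets, so that G is
-- at least as large as the cofinal family of null G_δ sets.
module Submission where

open import Defs
open import Axiom.DoubleNegationElimination using (DoubleNegationElimination; em⇒dne)
open import Axiom.ExcludedMiddle using (ExcludedMiddle)
open import Data.Bool using (Bool; true; false; _xor_)
open import Data.Bool.Properties using (xor-assoc; xor-comm; xor-identityʳ; xor-same; not-involutive)
open import Data.Fin using (zero; suc; toℕ)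
import Data.Integer as ℤ
open import Data.List using (List; []; _∷_; lookup; applyUpTo; replicate; _++_)
open import Data.List.Properties using (lookup-applyUpTo; ∷-injectiveˡ; ∷-injectiveʳ)
open import Data.Nat as ℕ using (ℕ; zero; suc; z≤n; s≤s)
open import Data.Nat.Binary as ℕᵇ using (ℕᵇ; 2[1+_]; 1+[2_])
import Data.Nat.Binary.Properties as ℕᵇ
import Data.Nat.Properties as ℕ
open import Data.Product using (Σ; ∃; _×_; _,_; proj₁; proj₂)
open import Data.Rational
  using (ℚ; mkℚ; 0ℚ; 1ℚ; ½; _+_; _*_; _≤_; _<_; *<*; toℚᵘ)
open import Data.Rational.Properties as ℚ using (toℚᵘ-cancel-≤; toℚᵘ-homo-*)
open import Data.Rational.Unnormalised as ℚᵘ using (mkℚᵘ; *≤*)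
import Data.Rational.Unnormalised.Properties as ℚᵘ
open import Data.Sum using (inj₁; inj₂; [_,_]′)
open import Function using (_∘_; id; case_of_)
open import Function.Bundles using (_⇔_; Bijection; Func; Injection; Surjection; mk⇔)
open import Function.Construct.Composition using (injection)
import Function.Construct.Symmetry as Symmetry
open import Function.Properties.Bijection using (Bijection⇒Inverse)
open import Function.Properties.Inverse using (Inverse⇒Injection)
open import Level using (0ℓ; _⊔_) renaming (suc to lsuc)
open import Relation.Binary using (Poset; Setoid; _Respects_)
open import Relation.Binary.PropositionalEquality
  using (_≡_; refl; sym; trans; cong; cong₂; subst; _≗_; setoid; module ≡-Reasoning)
open import Relation.Nullary using (¬_; Dec; does; yes; no; contradiction)
open import Relation.Nullary.Decidable using (dec-true; dec-false; True; toWitness; fromWitness)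
open import Relation.Unary using (Pred; _∈_; _∉_; _⊆_; _≐_; _∪_; _∖_; _⊢_)
open import Relation.Unary.Properties using (≐-refl; ≐-sym; ≐-trans)

-- Interleaved sequences and their partial sums.

alternate : ∀ {a} {A : Set a} → (ℕ → A) → (ℕ → A) → ℕ → A
alternate s t zero    = s zero
alternate s t (suc n) = alternate t (s ∘ suc) n

alternate-hitsˡ : ∀ {a} {A : Set a} (s t : ℕ → A) n → ∃ λ m → alternate s t m ≡ s n
alternate-hitsˡ s t zero    = zero , refl
alternate-hitsˡ s t (suc n) with alternate-hitsˡ (s ∘ suc) (t ∘ suc) n
... | m , eq = suc (suc m) , eq

alternate-hitsʳ : ∀ {a} {A : Set a} (s t : ℕ → A) n → ∃ λ m → alternate s t m ≡ t n
alternate-hitsʳ s t n with alternate-hitsˡ t (s ∘ suc) n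
... | m , eq = suc m , eq

alternate-∘ : ∀ {a b} {A : Set a} {B : Set b} (f : A → B) (s t : ℕ → A) →
  alternate (f ∘ s) (f ∘ t) ≗ f ∘ alternate s t
alternate-∘ f s t zero    = refl
alternate-∘ f s t (suc n) = alternate-∘ f t (s ∘ suc) n

∑-cong : ∀ {f g} → f ≗ g → ∀ n → ∑[ f < n ] ≡ ∑[ g < n ]
∑-cong f≗g zero    = refl
∑-cong f≗g (suc n) = cong₂ _+_ (∑-cong f≗g n) (f≗g n)

∑-head : ∀ f n → ∑[ f < suc n ] ≡ f zero + ∑[ f ∘ suc < n ]
∑-head f zero    = ℚ.+-comm 0ℚ (f zero)
∑-head f (suc n) = trans (cong (_+ f (suc n)) (∑-head f n)) (ℚ.+-assoc (f zero) _ _)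

-- Each unfolding of `alternate` exchanges the two sequences, and so does the induction. Only about
-- half of the terms on the right occur on the left; nonnegativity pays for the surplus.
∑-alternate : ∀ {f g} → (∀ k → 0ℚ ≤ f k) → (∀ k → 0ℚ ≤ g k) → ∀ n →
  ∑[ alternate f g < n ] ≤ ∑[ f < n ] + ∑[ g < n ]
∑-alternate         f≥0 g≥0 zero    = ℚ.≤-refl
∑-alternate {f} {g} f≥0 g≥0 (suc n) = begin
  ∑[ alternate f g < suc n ]                       ≡⟨ ∑-head (alternate f g) n ⟩
  f zero + ∑[ alternate g (f ∘ suc) < n ]          ≤⟨ ℚ.+-monoʳ-≤ (f zero) (∑-alternate g≥0 (f≥0 ∘ suc) n) ⟩
  f zero + (∑[ g < n ] + ∑[ f ∘ suc < n ])         ≡⟨ cong (f zero +_) (ℚ.+-comm ∑[ g < n ] _) ⟩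
  f zero + (∑[ f ∘ suc < n ] + ∑[ g < n ])         ≡⟨ ℚ.+-assoc (f zero) _ _ ⟨
  f zero + ∑[ f ∘ suc < n ] + ∑[ g < n ]           ≡⟨ cong (_+ ∑[ g < n ]) (∑-head f n) ⟨
  ∑[ f < suc n ] + ∑[ g < n ]                      ≡⟨ cong (λ q → ∑[ f < suc n ] + q) (ℚ.+-identityʳ _) ⟨
  ∑[ f < suc n ] + (∑[ g < n ] + 0ℚ)               ≤⟨ ℚ.+-monoʳ-≤ ∑[ f < suc n ] (ℚ.+-monoʳ-≤ ∑[ g < n ] (g≥0 n)) ⟩
  ∑[ f < suc n ] + ∑[ g < suc n ]                  ∎
  where open ℚ.≤-Reasoning

-- Powers of one half.

½^ : ℕ → ℚ
½^ zero    = 1ℚ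
½^ (suc n) = ½ * ½^ n

½+½ : ∀ p → ½ * p + ½ * p ≡ p
½+½ p = trans (sym (ℚ.*-distribʳ-+ p ½ ½)) (ℚ.*-identityˡ p)

½-pos : ∀ {p} → 0ℚ < p → 0ℚ < ½ * p
½-pos p>0 = ℚ.*-monoʳ-<-pos ½ p>0

½^-pos : ∀ n → 0ℚ < ½^ n
½^-pos zero    = *<* (ℤ.+<+ (s≤s z≤n))
½^-pos (suc n) = ½-pos (½^-pos n)

-- `mkℚᵘ` stores the denominator minus one, so the bound is 1/(n+1). The induction step rests on n+2
-- ≤ 2(n+1).
½^-≤1/suc : ∀ n → toℚᵘ (½^ n) ℚᵘ.≤ mkℚᵘ (ℤ.+ 1) n
½^-≤1/suc zero    = ℚᵘ.≤-refl
½^-≤1/suc (suc n) = begin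
  toℚᵘ (½ * ½^ n)                    ≃⟨ toℚᵘ-homo-* ½ (½^ n) ⟩
  mkℚᵘ (ℤ.+ 1) 1 ℚᵘ.* toℚᵘ (½^ n)    ≤⟨ ℚᵘ.*-monoʳ-≤-nonNeg (mkℚᵘ (ℤ.+ 1) 1) (½^-≤1/suc n) ⟩
  mkℚᵘ (ℤ.+ 1) 1 ℚᵘ.* mkℚᵘ (ℤ.+ 1) n ≤⟨ *≤* (ℤ.+≤+ (ℕ.*-monoʳ-≤ 1 (s≤s (ℕ.≤-trans (s≤s (ℕ.m≤m+n n 0)) (ℕ.m≤n+m _ n))))) ⟩
  mkℚᵘ (ℤ.+ 1) (suc n)               ∎
  where open ℚᵘ.≤-Reasoning

½^-small : ∀ {ε} → 0ℚ < ε → ∃ λ n → ½^ n ≤ ε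
½^-small {mkℚ (ℤ.+ zero) d _} (*<* (ℤ.+<+ ()))
½^-small {mkℚ (ℤ.-[1+ _ ]) d _} (*<* ())
-- Here ε is (a+1)/(d+1), which is at least 1/(d+1), so the exponent `d` suffices.
½^-small {mkℚ (ℤ.+ suc a) d _} _ = d , toℚᵘ-cancel-≤
  (ℚᵘ.≤-trans (½^-≤1/suc d) (*≤* (ℤ.+≤+ (ℕ.*-monoˡ-≤ (suc d) (s≤s (z≤n {a}))))))

-- Telescoping: each new term is half of the current remainder `½^ (n ℕ.+ m)`.
∑-½^ : ∀ m n → ∑[ (λ k → ½^ (suc k ℕ.+ m)) < n ] + ½^ (n ℕ.+ m) ≡ ½^ m
∑-½^ m zero    = ℚ.+-identityˡ _
∑-½^ m (suc n) = trans (ℚ.+-assoc ∑[ _ < n ] _ _)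
  (trans (cong (∑[ _ < n ] +_) (½+½ (½^ (n ℕ.+ m)))) (∑-½^ m n))

-- Measures of basic clopen sets and translation by a point.

μ-nonneg : ∀ s → 0ℚ ≤ μ s
μ-nonneg []      = ℚ.<⇒≤ (½^-pos zero)
μ-nonneg (_ ∷ s) = ℚ.*-monoˡ-≤-nonNeg ½ (μ-nonneg s)

μ-applyUpTo : ∀ (x : 2^ω) n → μ (applyUpTo x n) ≡ ½^ n
μ-applyUpTo x zero    = refl
μ-applyUpTo x (suc n) = cong (½ *_) (μ-applyUpTo (x ∘ suc) n)

xor-cancel-middle : ∀ a b c → (a xor b) xor (b xor c) ≡ a xor c
xor-cancel-middle true  true  c = refl
xor-cancel-middle true  false c = refl
xor-cancel-middle false true  c = not-involutive c
xor-cancel-middle false false c = refl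

xor-cancelʳ : ∀ a b → (a xor b) xor b ≡ a
xor-cancelʳ a b = trans (xor-assoc a b b) (trans (cong (a xor_) (xor-same b)) (xor-identityʳ a))

infixl 6 _⊕_

_⊕_ : 2^ω → 2^ω → 2^ω
(x ⊕ y) n = x n xor y n

shift : 2^ω → List Bool → List Bool
shift t []      = []
shift t (b ∷ s) = (b xor t zero) ∷ shift (t ∘ suc) s

μ-shift : ∀ t s → μ (shift t s) ≡ μ s
μ-shift t []      = refl
μ-shift t (_ ∷ s) = cong (½ *_) (μ-shift (t ∘ suc) s)

∈-shift : ∀ {t x} s → x ⊕ t ∈ [ s ] → x ∈ [ shift t s ]
∈-shift {t} {x} (b ∷ s) x⊕t∈s zero    =
  trans (sym (xor-cancelʳ (x zero) (t zero))) (cong (_xor t zero) (x⊕t∈s zero))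
∈-shift {t} {x} (b ∷ s) x⊕t∈s (suc i) = ∈-shift {t ∘ suc} {x ∘ suc} s (λ j → x⊕t∈s (suc j)) i

∈-applyUpTo : ∀ (x : 2^ω) n → x ∈ [ applyUpTo x n ]
∈-applyUpTo x n i = sym (lookup-applyUpTo x n i)

[]-resp : ∀ s → [ s ] Respects _≗_
[]-resp s x≗y x∈s i = trans (sym (x≗y (toℕ i))) (x∈s i)

-- The null ideal and its translation invariance.

IsNull-⊆ : ∀ {X Y} → X ⊆ Y → IsNull Y → IsNull X
IsNull-⊆ X⊆Y null ε ε>0 = let s , cover , small = null ε ε>0 in
  s , (λ x x∈X → cover x (X⊆Y x∈X)) , small

IsNull-∪ : ∀ {X Y} → IsNull X → IsNull Y → IsNull (X ∪ Y)
IsNull-∪ {X} {Y} X-null Y-null ε ε>0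
  with s , s-cover , s-small ← X-null (½ * ε) (½-pos ε>0)
     | t , t-cover , t-small ← Y-null (½ * ε) (½-pos ε>0) = alternate s t , cover , small
  where
  cover : ∀ x → x ∈ X ∪ Y → ∃ λ n → x ∈ [ alternate s t n ]
  cover x (inj₁ x∈X) = let n , x∈s = s-cover x x∈X; m , eq = alternate-hitsˡ s t n in
    m , subst (λ r → x ∈ [ r ]) (sym eq) x∈s
  cover x (inj₂ x∈Y) = let n , x∈t = t-cover x x∈Y; m , eq = alternate-hitsʳ s t n in
    m , subst (λ r → x ∈ [ r ]) (sym eq) x∈t

  small : ∀ n → ∑[ μ ∘ alternate s t < n ] ≤ ε
  small n = begin
    ∑[ μ ∘ alternate s t < n ]           ≡⟨ ∑-cong (alternate-∘ μ s t) n ⟨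
    ∑[ alternate (μ ∘ s) (μ ∘ t) < n ]   ≤⟨ ∑-alternate (μ-nonneg ∘ s) (μ-nonneg ∘ t) n ⟩
    ∑[ μ ∘ s < n ] + ∑[ μ ∘ t < n ]      ≤⟨ ℚ.+-mono-≤ (s-small n) (t-small n) ⟩
    ½ * ε + ½ * ε                        ≡⟨ ½+½ ε ⟩
    ε                                    ∎
    where open ℚ.≤-Reasoning

IsNull-translate : ∀ {X} t → IsNull X → IsNull ((_⊕ t) ⊢ X)
IsNull-translate t null ε ε>0 = let s , cover , small = null ε ε>0 in
  shift t ∘ s ,
  (λ x x⊕t∈X → let n , x⊕t∈s = cover (x ⊕ t) x⊕t∈X in n , ∈-shift {t} {x} (s n) x⊕t∈s) ,
  (λ n → ℚ.≤-trans (ℚ.≤-reflexive (∑-cong (μ-shift t ∘ s) n)) (small n))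

double : 2^ω → NullSet → NullSet
double t N = record
  { set      = N.set ∪ (_⊕ t) ⊢ N.set
  ; respects = λ x≗y → [ inj₁ ∘ N.respects x≗y , inj₂ ∘ N.respects (λ n → cong (_xor t n) (x≗y n)) ]′
  ; isNull   = IsNull-∪ N.isNull (IsNull-translate t N.isNull)
  }
  where module N = NullSet N

-- A cover is an infinite sequence and basic clopen sets have positive measure, so repeating one
-- neighbourhood would give unbounded sums. Neighbourhoods of lengths m+1, m+2, ... have total
-- measure at most `½^ m`.
IsNull-singleton : ∀ x → IsNull (_≗ x)
IsNull-singleton x ε ε>0 with m , ½^m≤ε ← ½^-small ε>0 =
  s , (λ y y≗x → 0 , []-resp (s 0) {x} {y} (sym ∘ y≗x) (∈-applyUpTo x (suc m))) , small
  where
  s : ℕ → List Bool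
  s k = applyUpTo x (suc k ℕ.+ m)

  small : ∀ n → ∑[ μ ∘ s < n ] ≤ ε
  small n = begin
    ∑[ μ ∘ s < n ]                                     ≡⟨ ∑-cong (λ k → μ-applyUpTo x (suc k ℕ.+ m)) n ⟩
    ∑[ (λ k → ½^ (suc k ℕ.+ m)) < n ]                  ≡⟨ ℚ.+-identityʳ _ ⟨
    ∑[ (λ k → ½^ (suc k ℕ.+ m)) < n ] + 0ℚ             ≤⟨ ℚ.+-monoʳ-≤ ∑[ _ < n ] (ℚ.<⇒≤ (½^-pos (n ℕ.+ m))) ⟩
    ∑[ (λ k → ½^ (suc k ℕ.+ m)) < n ] + ½^ (n ℕ.+ m)   ≡⟨ ∑-½^ m n ⟩
    ½^ m                                               ≤⟨ ½^m≤ε ⟩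
    ε                                                  ∎
    where open ℚ.≤-Reasoning

-- Codes for G_δ sets and for words.

-- A self-delimiting code of the pair (n, s): one set of words holds a whole sequence of sets of
-- words, its layers.
tag : ℕ → List Bool → List Bool
tag n s = replicate n true ++ false ∷ s

tag-injective : ∀ n n′ {s s′} → tag n s ≡ tag n′ s′ → n ≡ n′ × s ≡ s′
tag-injective zero    zero     refl = refl , refl
tag-injective (suc n) (suc n′) eq   with refl , eq′ ← tag-injective n n′ (∷-injectiveʳ eq) = refl , eq′

-- Layer `n` of `U` codes an open set, the union of its basic clopen sets; these open sets are
-- intersected.
Gδ : (List Bool → Bool) → Pred 2^ω 0ℓ
Gδ U x = ∀ n → ∃ λ s → U (tag n s) ≡ true × x ∈ [ s ]

Gδ-resp : ∀ U → Gδ U Respects _≗_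
Gδ-resp U x≗y x∈ n = let s , s∈U , x∈s = x∈ n in s , s∈U , []-resp s x≗y x∈s

Gδ-cong : ∀ {U V} → U ≗ V → Gδ U ⊆ Gδ V
Gδ-cong U≗V x∈ n = let s , s∈U , x∈s = x∈ n in s , trans (sym (U≗V _)) s∈U , x∈s

-- Bijective base-two numeration with digits 1 and 2, so that words of different lengths keep
-- different codes.
wordᵇ : List Bool → ℕᵇ
wordᵇ []          = ℕᵇ.zero
wordᵇ (true ∷ s)  = 2[1+ wordᵇ s ]
wordᵇ (false ∷ s) = 1+[2 wordᵇ s ]

wordᵇ-injective : ∀ s s′ → wordᵇ s ≡ wordᵇ s′ → s ≡ s′
wordᵇ-injective []          []           _  = refl
wordᵇ-injective []          (true ∷ _)   ()
wordᵇ-injective []          (false ∷ _)  ()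
wordᵇ-injective (true ∷ s)  (true ∷ s′)  eq = cong (true ∷_) (wordᵇ-injective s s′ (ℕᵇ.2[1+_]-injective eq))
wordᵇ-injective (false ∷ s) (false ∷ s′) eq = cong (false ∷_) (wordᵇ-injective s s′ (ℕᵇ.1+[2_]-injective eq))

word : List Bool → ℕ
word s = ℕᵇ.toℕ (wordᵇ s)

word-injective : ∀ {s s′} → word s ≡ word s′ → s ≡ s′
word-injective eq = wordᵇ-injective _ _ (ℕᵇ.toℕ-injective eq)

applyUpTo-injective : ∀ {x y : 2^ω} m n → applyUpTo x m ≡ applyUpTo y n →
  ∀ {k} → k ℕ.< m → x k ≡ y k
applyUpTo-injective (suc m) (suc n) eq {zero}  _         = ∷-injectiveˡ eq
applyUpTo-injective (suc m) (suc n) eq {suc k} (s≤s k<m) = applyUpTo-injective m n (∷-injectiveʳ eq) k<m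

does≡true⇒ : ∀ {p} {P : Set p} (P? : Dec P) → does P? ≡ true → P
does≡true⇒ (yes p) _ = p

-- The group of sparse sequences.

-- Through `word`, `v` is a set of nodes of the binary tree; it is to be almost disjoint from the
-- branch of `r`.
VanishesAlong : 2^ω → 2^ω → Set
VanishesAlong r v = ∃ λ N → ∀ n → N ℕ.≤ n → v (word (applyUpTo r n)) ≡ false

Sparse : 2^ω → Set
Sparse v = ∃ λ (d : ℕ → 2^ω) → ∀ r → (∀ i → ¬ r ≗ d i) → VanishesAlong r v

Sparse-resp : Sparse Respects _≗_
Sparse-resp u≗v (d , vanishes) = d , λ r r∉d → let N , eq = vanishes r r∉d in
  N , λ n N≤n → trans (sym (u≗v _)) (eq n N≤n)

Sparse-0 : Sparse (λ _ → false)
Sparse-0 = (λ _ _ → false) , λ r _ → 0 , λ _ _ → refl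

Sparse-⊕ : ∀ {u v} → Sparse u → Sparse v → Sparse (u ⊕ v)
Sparse-⊕ (d , u-vanishes) (e , v-vanishes) = alternate d e , λ r r∉ →
  let M , u≡0 = u-vanishes r λ i r≗dᵢ → let m , eq = alternate-hitsˡ d e i in
                  r∉ m (subst (r ≗_) (sym eq) r≗dᵢ)
      N , v≡0 = v-vanishes r λ i r≗eᵢ → let m , eq = alternate-hitsʳ d e i in
                  r∉ m (subst (r ≗_) (sym eq) r≗eᵢ)
  in M ℕ.⊔ N , λ n M⊔N≤n →
    cong₂ _xor_ (u≡0 n (ℕ.m⊔n≤o⇒m≤o M N M⊔N≤n)) (v≡0 n (ℕ.m⊔n≤o⇒n≤o M N M⊔N≤n))

modSparse : Setoid 0ℓ 0ℓ
modSparse = record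
  { Carrier       = 2^ω
  ; _≈_           = λ x y → Sparse (x ⊕ y)
  ; isEquivalence = record
    { refl  = λ {x} → Sparse-resp (λ n → sym (xor-same (x n))) Sparse-0
    ; sym   = λ {x} {y} → Sparse-resp (λ n → xor-comm (x n) (y n))
    ; trans = λ {x} {y} {z} x~y y~z →
        Sparse-resp (λ n → xor-cancel-middle (x n) (y n) (z n)) (Sparse-⊕ {x ⊕ y} {y ⊕ z} x~y y~z)
    }
  }

-- Consequences of excluded middle and choice.

module Classical
  (em : ∀ {ℓ} → ExcludedMiddle ℓ)
  (ac : ∀ {a ℓ₁ b ℓ₂} → AxiomOfChoice a ℓ₁ b ℓ₂)
  where

  dne : ∀ {ℓ} → DoubleNegationElimination ℓ
  dne = em⇒dne em

  ¬∀⇒∃¬ : ∀ {a p} {A : Set a} {P : A → Set p} → ¬ (∀ x → P x) → ∃ λ x → ¬ P x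
  ¬∀⇒∃¬ ¬∀ = dne λ ¬∃ → ¬∀ λ x → dne λ ¬Px → ¬∃ (x , ¬Px)

  -- Choice is applied to the identity as a surjection from propositional equality onto `S`; its
  -- section sends equivalent elements to identical ones.
  canonical : ∀ {a ℓ} (S : Setoid a ℓ) →
    Σ (Setoid.Carrier S → Setoid.Carrier S) λ f →
      (∀ {x y} → Setoid._≈_ S x y → f x ≡ f y) × (∀ x → Setoid._≈_ S (f x) x)
  canonical S = let g , g≈id = ac (setoid Carrier) S id-surjection in
    Func.to g , Func.cong g , g≈id
    where
    open Setoid S using (Carrier; reflexive)

    id-surjection : Surjection (setoid Carrier) S
    id-surjection = record { to = id ; cong = reflexive ; surjective = λ y → y , reflexive }

  module _ {a b ℓ₁ ℓ₂} {A : Setoid a ℓ₁} {B : Setoid b ℓ₂} where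
    private
      module A = Setoid A
      module B = Setoid B

    -- The witness from `total` may differ within an equivalence class; evaluating it at the
    -- canonical representative yields a setoid map.
    rel⇒injection : ∀ {r} (R : A.Carrier → B.Carrier → Set r) → (∀ x → ∃ (R x)) →
      (∀ {x y u v} → R x u → R y v → u B.≈ v → x A.≈ y) → Injection A B
    rel⇒injection R total injective with canonical A
    ... | f , f-cong , f≈id = record
      { to        = λ x → proj₁ (total (f x))
      ; cong      = λ x≈y → B.reflexive (cong (proj₁ ∘ total) (f-cong x≈y))
      ; injective = λ {x} {y} u≈v → A.trans (A.sym (f≈id x))
          (A.trans (injective (proj₂ (total (f x))) (proj₂ (total (f y))) u≈v) (f≈id y))
      }

  -- The Cantor-Bernstein theorem for setoids.

  module CantorBernstein {a b ℓ₁ ℓ₂} {A : Setoid a ℓ₁} {B : Setoid b ℓ₂}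
    (F : Injection A B) (G : Injection B A)
    where
    private
      module A = Setoid A
      module B = Setoid B
      module F = Injection F
      module G = Injection G

    -- The elements whose backward orbit ends in `A`, outside the range of `G`. The bijection `h`
    -- applies `F` to them and inverts `G` elsewhere.
    data FromA : A.Carrier → Set (a ⊔ b ⊔ ℓ₁) where
      base : ∀ {x} → ¬ (∃ λ y → G.to y A.≈ x) → FromA x
      step : ∀ {x y} → FromA x → G.to (F.to x) A.≈ y → FromA y

    FromA-resp : ∀ {x y} → x A.≈ y → FromA x → FromA y
    FromA-resp x≈y (base ∉G)   = base λ (z , Gz≈y) → ∉G (z , A.trans Gz≈y (A.sym x≈y))
    FromA-resp x≈y (step p eq) = step p (A.trans eq x≈y)

    preimage : ∀ x → ¬ FromA x → ∃ λ y → G.to y A.≈ x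
    preimage x ¬p = dne (¬p ∘ base)

    h : ∀ x → Dec (FromA x) → B.Carrier
    h x (yes _) = F.to x
    h x (no ¬p) = proj₁ (preimage x ¬p)

    h-cong : ∀ {x y} → x A.≈ y → ∀ p? q? → h x p? B.≈ h y q?
    h-cong         x≈y (yes _) (yes _) = F.cong x≈y
    h-cong {x} {y} x≈y (no ¬p) (no ¬q) = G.injective
      (A.trans (proj₂ (preimage x ¬p)) (A.trans x≈y (A.sym (proj₂ (preimage y ¬q)))))
    h-cong         x≈y (yes p) (no ¬q) = contradiction (FromA-resp x≈y p) ¬q
    h-cong         x≈y (no ¬p) (yes q) = contradiction (FromA-resp (A.sym x≈y) q) ¬p

    h-injective : ∀ {x y} p? q? → h x p? B.≈ h y q? → x A.≈ y
    h-injective         (yes _) (yes _) eq = F.injective eq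
    h-injective {x} {y} (no ¬p) (no ¬q) eq =
      A.trans (A.sym (proj₂ (preimage x ¬p))) (A.trans (G.cong eq) (proj₂ (preimage y ¬q)))
    -- Equal values would make `y` equivalent to `G.to (F.to x)`, so `FromA` would pass from `x` to
    -- `y`.
    h-injective {x} {y} (yes p) (no ¬q) eq =
      contradiction (step p (A.trans (G.cong eq) (proj₂ (preimage y ¬q)))) ¬q
    h-injective {x} {y} (no ¬p) (yes q) eq =
      contradiction (step q (A.trans (G.cong (B.sym eq)) (proj₂ (preimage x ¬p)))) ¬p

    h-surjective : ∀ y → ∃ λ x → ∀ {z} → z A.≈ x → h z em B.≈ y
    h-surjective y with em {P = FromA (G.to y)}
    ... | no ¬p = G.to y , λ z≈Gy → B.trans (h-cong z≈Gy em (no ¬p))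
                                      (G.injective (proj₂ (preimage (G.to y) ¬p)))
    ... | yes (base ∉G)        = contradiction (y , A.refl) ∉G
    ... | yes (step {x} p eq)  = x , λ z≈x → B.trans (h-cong z≈x em (yes p)) (G.injective eq)

    bijection : Bijection A B
    bijection = record
      { to        = λ x → h x em
      ; cong      = λ x≈y → h-cong x≈y em em
      ; bijective = h-injective em em , h-surjective
      }

  -- Branches, supports and Kőnig's diagonal argument.

  branch : 2^ω → 2^ω
  branch r k = does (em {P = ∃ λ n → word (applyUpTo r n) ≡ k})

  branch-on : ∀ r n → branch r (word (applyUpTo r n)) ≡ true
  branch-on r n = dec-true em (n , refl)

  -- Once a prefix of `r′` includes a position where `r` and `r′` differ, it is no prefix of `r`.
  branch-off : ∀ {r r′} → ¬ r′ ≗ r → VanishesAlong r′ (branch r)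
  branch-off {r} {r′} r′≇r = let k , r′k≢rk = ¬∀⇒∃¬ r′≇r in
    suc k , λ n k<n → dec-false em λ (m , eq) →
      r′k≢rk (applyUpTo-injective n m (sym (word-injective eq)) k<n)

  Sparse-branch : ∀ r → Sparse (branch r)
  Sparse-branch r = (λ _ → r) , λ r′ r′∉ → branch-off (r′∉ 0)

  private
    representative : 2^ω → 2^ω
    representative = proj₁ (canonical modSparse)

    offset-sparse : ∀ x → Sparse (representative x ⊕ x)
    offset-sparse = proj₂ (proj₂ (canonical modSparse))

  support : 2^ω → ℕ → 2^ω
  support x = proj₁ (offset-sparse x)

  -- Since `branch r` is sparse, `x` and `y` share a representative `ρ`. If `r` were in neither
  -- support, `ρ ⊕ x` and `ρ ⊕ y`, hence `x ⊕ y`, would vanish eventually along `r`, where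
  -- `branch r` is always `true`.
  branch-∈-support : ∀ {r x y} → x ⊕ y ≗ branch r →
    (∀ i → ¬ r ≗ support x i) → ¬ (∀ i → ¬ r ≗ support y i)
  branch-∈-support {r} {x} {y} x⊕y≗branch r∉x r∉y = contradiction absurd λ ()
    where
    ρ : 2^ω
    ρ = representative x

    ρ≡ : ρ ≡ representative y
    ρ≡ = proj₁ (proj₂ (canonical modSparse))
           (Sparse-resp (sym ∘ x⊕y≗branch) (Sparse-branch r))

    x-vanishes : VanishesAlong r (ρ ⊕ x)
    x-vanishes = proj₂ (offset-sparse x) r r∉x

    y-vanishes : VanishesAlong r (ρ ⊕ y)
    y-vanishes = subst (λ c → VanishesAlong r (c ⊕ y)) (sym ρ≡) (proj₂ (offset-sparse y) r r∉y)

    n k : ℕ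
    n = proj₁ x-vanishes ℕ.⊔ proj₁ y-vanishes
    k = word (applyUpTo r n)

    absurd : true ≡ false
    absurd = begin
      true                        ≡⟨ branch-on r n ⟨
      branch r k                  ≡⟨ x⊕y≗branch k ⟨
      x k xor y k                 ≡⟨ xor-cancel-middle (x k) (ρ k) (y k) ⟨
      (x k xor ρ k) xor (ρ k xor y k)
        ≡⟨ cong (_xor (ρ k xor y k)) (xor-comm (x k) (ρ k)) ⟩
      (ρ k xor x k) xor (ρ k xor y k)
        ≡⟨ cong₂ _xor_ (proj₂ x-vanishes n (ℕ.m≤m⊔n _ _)) (proj₂ y-vanishes n (ℕ.m≤n⊔m _ _)) ⟩
      false                       ∎
      where open ≡-Reasoning

  -- If the n-th map missed U n for every n, then a sequence whose n-th part is
  -- U n would be in the range of none of them.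
  some-section-onto : ∀ {j} {J : Set j} (φ : ℕ → J → 2^ω) →
    (∀ r → ∃ λ n → ∃ λ j → r ≗ φ n j) →
    ∃ λ n → ∀ (U : List Bool → Bool) → ∃ λ j → U ≗ φ n j ∘ word ∘ tag n
  some-section-onto φ onto = dne λ ¬∃ →
    let missed : ∀ n → ∃ λ U → ¬ ∃ λ j → U ≗ φ n j ∘ word ∘ tag n
        missed n = ¬∀⇒∃¬ λ ∀U → ¬∃ (n , ∀U)
        n , j , eq = onto (diagonal (proj₁ ∘ missed))
    in proj₂ (missed n) (j , λ s → trans (sym (diagonal-tag (proj₁ ∘ missed) n s)) (eq (word (tag n s))))
    where
    diagonal : (ℕ → List Bool → Bool) → 2^ω
    diagonal U k = does (em {P = ∃ λ n → ∃ λ s → word (tag n s) ≡ k × U n s ≡ true})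

    diagonal-tag : ∀ U n s → diagonal U (word (tag n s)) ≡ U n s
    diagonal-tag U n s with U n s in eq
    ... | true  = dec-true em (n , s , refl , eq)
    ... | false = dec-false em λ (n′ , s′ , eq₁ , eq₂) →
      case tag-injective n′ n (word-injective eq₁) of λ where
        (refl , refl) → contradiction (trans (sym eq₂) eq) λ ()

  -- Null G_δ hulls.

  -- The cover of `X` for `½^ n` becomes layer `n` of `U`. As the layer contains nothing else, the
  -- same cover works for `Gδ U`.
  Gδ-hull : ∀ {X} → IsNull X → ∃ λ U → X ⊆ Gδ U × IsNull (Gδ U)
  Gδ-hull {X} null = U , X⊆ , Gδ-null
    where
    s : ℕ → ℕ → List Bool
    s n = proj₁ (null (½^ n) (½^-pos n))

    U : List Bool → Bool
    U w = does (em {P = ∃ λ n → ∃ λ m → w ≡ tag n (s n m)})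

    X⊆ : X ⊆ Gδ U
    X⊆ {x} x∈X n = let m , x∈s = proj₁ (proj₂ (null (½^ n) (½^-pos n))) x x∈X in
      s n m , dec-true em (n , m , refl) , x∈s

    Gδ-null : IsNull (Gδ U)
    Gδ-null ε ε>0 with n , ½^n≤ε ← ½^-small ε>0 = s n , cover ,
      λ k → ℚ.≤-trans (proj₂ (proj₂ (null (½^ n) (½^-pos n))) k) ½^n≤ε
      where
      cover : ∀ x → x ∈ Gδ U → ∃ λ m → x ∈ [ s n m ]
      cover x x∈ with w , w∈U , x∈w ← x∈ n
                 with n′ , m , eq ← does≡true⇒ em w∈U
                 with refl , refl ← tag-injective n n′ eq = m , x∈w

  -- From comparable to cofinal families.

  -- `H j` need not be null: the family consists of the null sets that equal some `H j`. Choosing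
  -- such an index for each member injects the family into `J`.
  cofinal-family : (J : Setoid (lsuc 0ℓ) 0ℓ) (H : Setoid.Carrier J → Pred 2^ω 0ℓ) →
    (∀ {i j} → Setoid._≈_ J i j → H i ⊆ H j) →
    (∀ N → ∃ λ A → ∃ λ j → NullSet.set A ≐ H j × NullSet.set N ⊆ NullSet.set A) →
    ∃ λ F → IsCofinal null F × Injection (members null F) J
  cofinal-family J H H-mono cofinal =
    F , (λ N → let A , j , A≐H , N⊆A = cofinal N in A , (j , A≐H) , N⊆A) ,
    rel⇒injection (λ (A , _) j → NullSet.set A ≐ H j) proj₂
      (λ A≐Hi B≐Hj i≈j → ≐-trans A≐Hi
        (≐-trans (H-mono i≈j , H-mono (Setoid.sym J i≈j)) (≐-sym B≐Hj)))
    where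
    F : Family null
    F = record
      { member   = λ A → ∃ λ j → NullSet.set A ≐ H j
      ; respects = λ A≐B (j , A≐H) → j , ≐-trans (≐-sym A≐B) A≐H
      }

  singleton : 2^ω → NullSet
  singleton x = record
    { set      = _≗ x
    ; respects = λ y≗z y≗x n → trans (sym (y≗z n)) (y≗x n)
    ; isNull   = IsNull-singleton x
    }

  module _ (G : Family null∖❴∅❵) (comparable : IsComparable null∖❴∅❵ G) where
    private
      J : Setoid (lsuc 0ℓ) 0ℓ
      J = members null∖❴∅❵ G
      module J = Setoid J

      ⟦_⟧ : J.Carrier → NullSet
      ⟦ (X , _) , _ ⟧ = X

      set : J.Carrier → Pred 2^ω 0ℓ
      set j = NullSet.set ⟦ j ⟧

      canon : J.Carrier → J.Carrier
      canon = proj₁ (canonical J)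

      inhabited : ∀ j → ∃ (set j)
      inhabited ((X , X≭∅) , _) = dne λ ¬∃ → X≭∅ ((λ x∈X → ¬∃ (_ , x∈X)) , λ ())

      -- Passing through `canon` gives equal members of `G` the same point, so that families built
      -- from points respect equality in `J`.
      point : J.Carrier → 2^ω
      point = proj₁ ∘ inhabited ∘ canon

      point-∈ : ∀ j → set j (point j)
      point-∈ j = proj₁ (proj₂ (proj₂ (canonical J)) j) (proj₂ (inhabited (canon j)))

      point-cong : ∀ {i j} → i J.≈ j → point i ≡ point j
      point-cong i≈j = cong (proj₁ ∘ inhabited) (proj₁ (proj₂ (canonical J)) i≈j)

      -- True brings the existential over J, which lives in Set₁, down to Set.
      Points : Pred 2^ω 0ℓ
      Points x = True (em {P = ∃ λ j → x ≗ point j})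

      Points-resp : Points Respects _≗_
      Points-resp x≗y x∈ = let j , x≗pⱼ = toWitness x∈ in
        fromWitness (j , λ n → trans (sym (x≗y n)) (x≗pⱼ n))

      deletePoints : NullSet → NullSet
      deletePoints Y = record
        { set      = Y.set ∖ Points
        ; respects = λ x≗y (x∈Y , x∉) → Y.respects x≗y x∈Y , x∉ ∘ Points-resp (sym ∘ x≗y)
        ; isNull   = IsNull-⊆ proj₁ Y.isNull
        }
        where module Y = NullSet Y

      someMember : J.Carrier
      -- Any element of the poset yields a member of `G`; a singleton is at hand.
      someMember = let q , q∈G , _ = comparable (singleton (λ _ → false) , λ ≐∅ → proj₁ ≐∅ λ _ → refl)
        in q , q∈G

      ∖Points-below : ∀ Y → ∃ λ j → NullSet.set Y ∖ Points ⊆ set j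
      ∖Points-below Y with em {P = ∃ (NullSet.set Y ∖ Points)}
      -- The empty set is no element of the poset, so comparability says nothing here and any member
      -- of `G` will do.
      ... | no  empty     = someMember , λ x∈ → contradiction (_ , x∈) empty
      ... | yes (_ , x∈Z) with comparable (deletePoints Y , λ Z≐∅ → proj₁ Z≐∅ x∈Z)
      ...   | q , q∈G , inj₁ Z⊆q = (q , q∈G) , Z⊆q
      ...   | q , q∈G , inj₂ q⊆Z = contradiction (fromWitness ((q , q∈G) , λ _ → refl))
                                     (proj₂ (q⊆Z (point-∈ (q , q∈G))))

      Cofinal↪G : Set (lsuc (lsuc 0ℓ))
      Cofinal↪G = ∃ λ F → IsCofinal null F × Injection (members null F) J

      cofinal-if-new-branch : ∀ r → ¬ (∃ λ n → ∃ λ j → r ≗ support (point j) n) → Cofinal↪G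
      cofinal-if-new-branch r r∉ = cofinal-family J (NullSet.set ∘ double t ∘ ⟦_⟧)
        (λ (i⊆j , _) → [ inj₁ ∘ i⊆j , inj₂ ∘ i⊆j ]′)
        λ N → let j , below = ∖Points-below (double t N) in
          double t ⟦ j ⟧ , j , ≐-refl , λ {x} x∈N → case em {P = x ∈ Points} of λ where
            -- Of `x` and `x ⊕ t`, at least one avoids `Points`. Both lie in `double t N`, because
            -- translating twice by `t` returns to `x`.
            (no  x∉) → inj₁ (below (inj₁ x∈N , x∉))
            (yes x∈) → inj₂ (below
              ( inj₂ (NullSet.respects N (λ n → sym (xor-cancelʳ (x n) (t n))) x∈N)
              , Points-translate x∈))
        where
        t : 2^ω
        t = branch r

        Points-translate : ∀ {x} → x ∈ Points → x ⊕ t ∉ Points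
        Points-translate {x} x∈ x⊕t∈ with i , x≗pᵢ ← toWitness x∈ | j , x⊕t≗pⱼ ← toWitness x⊕t∈ =
          branch-∈-support {r} {point i} {point j}
            (λ n → trans (cong₂ _xor_ (sym (x≗pᵢ n)) (sym (x⊕t≗pⱼ n)))
                     -- With `false` as first argument this reads `x ⊕ (x ⊕ t) ≗ t`.
                     (xor-cancel-middle false (x n) (t n)))
            (λ n r≗ → r∉ (n , i , r≗)) (λ n r≗ → r∉ (n , j , r≗))

      -- Members of `G` act here only as codes, via their points: one coordinate of the supports
      -- yields every `U`, in particular a code of a null hull of any given `N`.
      cofinal-if-no-new-branch : (∀ r → ∃ λ n → ∃ λ j → r ≗ support (point j) n) → Cofinal↪G
      cofinal-if-no-new-branch onto with n , U-onto ← some-section-onto (λ n j → support (point j) n) onto =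
        cofinal-family J (λ j → Gδ (support (point j) n ∘ word ∘ tag n))
          (λ i≈j {x} → Gδ-cong (λ s → cong (λ p → support p n (word (tag n s))) (point-cong i≈j)) {x})
          λ N → let U , N⊆U , U-null = Gδ-hull (NullSet.isNull N); j , U≗ = U-onto U in
            record { set = Gδ U ; respects = Gδ-resp U ; isNull = U-null } ,
            j , ((λ {x} → Gδ-cong U≗ {x}) , (λ {x} → Gδ-cong (sym ∘ U≗) {x})) , N⊆U

    comparable⇒cofinal : Cofinal↪G
    comparable⇒cofinal with em {P = ∃ λ r → ¬ (∃ λ n → ∃ λ j → r ≗ support (point j) n)}
    ... | yes (r , r∉) = cofinal-if-new-branch r r∉
    ... | no  none     = cofinal-if-no-new-branch λ r → dne λ r∉ → none (r , r∉)

  -- From cofinal to comparable families, and equality of the cardinals.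

  -- A member of `F` above a nonempty set is nonempty, so removing the empty set from `F` does no
  -- harm.
  cofinal⇒comparable : ∀ F → IsCofinal null F →
    ∃ λ G → IsComparable null∖❴∅❵ G × Injection (members null∖❴∅❵ G) (members null F)
  cofinal⇒comparable F cofinal =
    record { member = F.member ∘ proj₁ ; respects = F.respects } ,
    (λ (p , p≭∅) → let q , q∈F , p⊆q = cofinal p in
      (q , λ q≐∅ → p≭∅ ((proj₁ q≐∅ ∘ p⊆q) , λ ())) , q∈F , inj₁ p⊆q) ,
    record { to = λ ((q , _) , q∈F) → q , q∈F ; cong = id ; injective = id }
    where module F = Family F

  -- `back` carries the lower bound over to `P′`; `forth` turns a family of least size into one that
  -- is no larger.
  IsMinimalSize-transfer : ∀ {c ℓ₁ ℓ₂ ℓ₃ ℓ₄} (P : Poset c ℓ₁ ℓ₂) (P′ : Poset c ℓ₃ ℓ₄)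
    {Q : Family P → Set (c ⊔ ℓ₂)} {Q′ : Family P′ → Set (c ⊔ ℓ₄)} →
    (∀ F → Q F → ∃ λ F′ → Q′ F′ × Injection (members P′ F′) (members P F)) →
    (∀ F′ → Q′ F′ → ∃ λ F → Q F × Injection (members P F) (members P′ F′)) →
    ∀ {K} → IsMinimalSize P Q K → IsMinimalSize P′ Q′ K
  IsMinimalSize-transfer P P′ {Q′ = Q′} forth back {K} ((F , QF , K⤖F) , minimal)
    with F′ , Q′F′ , F′↪F ← forth F QF =
    -- `K` injects into `F′` by the lower bound, and `F′` injects into `F`, which is in bijection
    -- with `K`.
    (F′ , Q′F′ , CantorBernstein.bijection (minimal′ F′ Q′F′)
      (injection F′↪F (Inverse⇒Injection (Symmetry.inverse (Bijection⇒Inverse K⤖F))))) , minimal′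
    where
    minimal′ : ∀ F′ → Q′ F′ → Injection (setoid K) (members P′ F′)
    minimal′ F′ Q′F′ = let F , QF , F↪F′ = back F′ Q′F′ in injection (minimal F QF) F↪F′

mainTheorem9 :
    (∀ {ℓ} → ExcludedMiddle ℓ) →
    (∀ {a ℓ₁ b ℓ₂} → AxiomOfChoice a ℓ₁ b ℓ₂) →
    (K : Set₁) → Is-𝔠𝔭 null∖❴∅❵ K ⇔ Is-cof null K
mainTheorem9 em ac K = mk⇔
  (IsMinimalSize-transfer null∖❴∅❵ null comparable⇒cofinal cofinal⇒comparable)
  (IsMinimalSize-transfer null null∖❴∅❵ cofinal⇒comparable comparable⇒cofinal)
  where open Classical em ac
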